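{- Let $G$ be a finite, simple, undirected graph. Then $G$ is $(Z_+, Z)$-perfect (that is, $Z_+(H) = Z(H)$ for every induced subgraph $H$ of $G$) if and only if $G$ is claw-free.
   Context: All graphs are finite, simple and undirected. A graph is claw-free if it has no induced subgraph isomorphic to $K_{1,3}$. Forcing process: the vertex set is partitioned as $V(G) = B \cup W$ into blue vertices $B$ and white vertices $W$. A color change rule specifies when a blue vertex $u \in B$ may force a white vertex $v \in W$ to become blue. At each time step some set of valid forces (with respect to the current coloring) is performed, no white vertex being forced by more than one vertex, and the forced vertices are moved from $W$ to $B$. This is repeated until no further color changes are possible. If all vertices of $G$ are then blue, the initial set $B$ is called a forcing set of $G$ under the given rule. Standard forcing rule: a blue vertex $u$ may force a white vertex $v$ if $v$ is the only white neighbor of $u$ in $G$. $Z(G)$, the standard forcing number, is the minimum cardinality of a forcing set under this rule. Positive semidefinite forcing rule: a blue vertex $u$ may force a white vertex $v$ if $v$ is the only neighbor of $u$ in the connected component of the induced subgraph $G[W]$ that contains $v$, where $W$ is the current set of white vertices. $Z_+(G)$, the positive semidefinite forcing number, is the minimum cardinality of a forcing set under this rule. A graph $G$ is $(Z_+, Z)$-perfect if $Z_+(H) = Z(H)$ for every induced subgraph $H$ of $G$. -}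

module Defs where

open import Data.Empty using (⊥-elim)
open import Data.Fin using (Fin; zero; suc)
open import Data.Fin.Properties using (_≟_; any?; all?)
open import Data.Fin.Subset using (Subset; _∈_; _∉_; _⊆_; _⊂_; _⊃_; _-_; ∁; ⊤; ∣_∣)
open import Data.Fin.Subset.Induction using (Acc; acc; ⊂-wellFounded; ⊃-wellFounded)
open import Data.Fin.Subset.Properties
  using (_∈?_; _⊆?_; _⊂?_; anySubset?; ⊆-antisym; ⊆⊤; p─q⊆p; x∈p⇒p-x⊂p; x∈p∧x≢y⇒x∈p-y)
open import Data.Nat using (ℕ; _<_; _≤_)
open import Data.Nat.Induction using (<-wellFounded)
open import Data.Nat.Properties using (_<?_; ≮⇒≥)
open import Data.Product using (∃; ∃-syntax; _×_; _,_; proj₁; proj₂)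
open import Data.Sum using (_⊎_; inj₁; inj₂)
open import Function using (_⇔_; _∘_; id)
open import Function.Definitions using (Injective)
open import Relation.Binary.Construct.Closure.ReflexiveTransitive using (Star; ε; _◅_; gmap)
open import Relation.Binary.PropositionalEquality using (_≡_; refl; subst)
open import Relation.Nullary using (¬_; Dec; yes; no)
open import Relation.Nullary.Decidable using (map′; ¬?; _×-dec_; _→-dec_)

private
  variable
    m n : ℕ

record Graph (n : ℕ) : Set₁ where
  infix 4 _~_ _~?_
  field
    _~_      : Fin n → Fin n → Set
    _~?_     : ∀ u v → Dec (u ~ v)
    ~-sym    : ∀ {u v} → u ~ v → v ~ u
    ~-irrefl : ∀ {v} → ¬ (v ~ v)

-- H is (isomorphic to) an induced subgraph of G: an injection of vertices
-- that preserves and reflects adjacency.  As H varies, the images run over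
-- all induced subgraphs G[S], S a set of vertices.
record InducedSubgraph (H : Graph m) (G : Graph n) : Set where
  private
    module H = Graph H
    module G = Graph G
  field
    embed           : Fin m → Fin n
    embed-injective : Injective _≡_ _≡_ embed
    embed-adjacent  : ∀ u v → (u H.~ v) ⇔ (embed u G.~ embed v)

data ClawEdge : Fin 4 → Fin 4 → Set where
  out : ∀ i → ClawEdge zero (suc i)
  inn : ∀ i → ClawEdge (suc i) zero

K₁,₃ : Graph 4
K₁,₃ = record
  { _~_      = ClawEdge
  ; _~?_     = λ { zero zero → no λ () ; zero (suc i) → yes (out i)
                 ; (suc i) zero → yes (inn i) ; (suc _) (suc _) → no λ () }
  ; ~-sym    = λ { (out i) → inn i ; (inn i) → out i }
  ; ~-irrefl = λ ()
  }

ClawFree : Graph n → Set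
ClawFree G = ¬ InducedSubgraph K₁,₃ G

-- `R B u v`: when B is the set of blue vertices, the blue vertex u may force
-- the white vertex v.  That u is blue and v is white is imposed by `Step`.
Rule : ℕ → Set₁
Rule n = Subset n → Fin n → Fin n → Set

-- One time step, from blue set B to blue set B′.  The component `newly-forced`
-- assigns to every newly blue vertex the one vertex that forces it.
record Step (R : Rule n) (B B′ : Subset n) : Set where
  constructor step
  field
    stay-blue    : B ⊆ B′
    newly-forced : ∀ v → v ∈ B′ → v ∉ B → ∃[ u ] (u ∈ B × R B u v)

ForcingSet : Rule n → Subset n → Set
ForcingSet R B = Star (Step R) B ⊤

IsForcingNumber : Rule n → ℕ → Set
IsForcingNumber R k =
  (∃[ B ] (ForcingSet R B × ∣ B ∣ ≡ k)) × (∀ B → ForcingSet R B → k ≤ ∣ B ∣)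

module _ (G : Graph n) where
  open Graph G

  standardRule : Rule n
  standardRule B u v = u ~ v × (∀ w → w ∉ B → u ~ w → w ≡ v)

  EdgeIn : Subset n → Fin n → Fin n → Set
  EdgeIn W x y = x ∈ W × y ∈ W × x ~ y

  SameComponent : Subset n → Fin n → Fin n → Set
  SameComponent W x y = x ∈ W × y ∈ W × Star (EdgeIn W) x y

  psdRule : Rule n
  psdRule B u v = u ~ v × (∀ w → SameComponent (∁ B) v w → u ~ w → w ≡ v)

-- Both rules are decidable, hence so is being a forcing set, and the minimum
-- cardinality of a forcing set exists.

module _ (G : Graph n) where
  open Graph G

  standardRule? : ∀ B u v → Dec (standardRule G B u v)
  standardRule? B u v =
    (u ~? v) ×-dec all? λ w → ¬? (w ∈? B) →-dec ((u ~? w) →-dec (w ≟ v))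

  private
    x∉p-x : ∀ {p : Subset n} {x} → x ∉ p - x
    x∉p-x {p} {x} x∈p-x with x∈p⇒p-x⊂p (p─q⊆p p _ x∈p-x)
    ... | _ , z , z∈p , z∉p-x with z ≟ x
    ...   | yes refl = z∉p-x x∈p-x
    ...   | no  z≢x  = z∉p-x (x∈p∧x≢y⇒x∈p-y z∈p z≢x)

    -- A way from v to w whose remainder avoids v.
    Leaves : Subset n → Fin n → Fin n → Set
    Leaves W v w = v ≡ w ⊎ (∃[ y ] (v ~ y × y ∈ W - v × Star (EdgeIn G (W - v)) y w))

    fromRemoved : ∀ {W v w} → Star (EdgeIn G (W - v)) v w → Leaves W v w
    fromRemoved ε                 = inj₁ refl
    fromRemoved ((v∈ , _) ◅ _)    = ⊥-elim (x∉p-x v∈)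

    lastVisit : ∀ {W} v {x w} → Star (EdgeIn G W) x w →
                Star (EdgeIn G (W - v)) x w ⊎ Leaves W v w
    lastVisit v ε = inj₁ ε
    lastVisit v {x} (_◅_ {j = y} (x∈W , y∈W , x~y) p) with lastVisit v p
    ... | inj₂ l = inj₂ l
    ... | inj₁ q with y ≟ v
    ...   | yes refl = inj₂ (fromRemoved q)
    ...   | no  y≢v with x ≟ v
    ...     | yes refl = inj₂ (inj₂ (y , x~y , x∈p∧x≢y⇒x∈p-y y∈W y≢v , q))
    ...     | no  x≢v  =
      inj₁ ((x∈p∧x≢y⇒x∈p-y x∈W x≢v , x∈p∧x≢y⇒x∈p-y y∈W y≢v , x~y) ◅ q)

    leaves : ∀ {W v w} → Star (EdgeIn G W) v w → Leaves W v w
    leaves {v = v} p with lastVisit v p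
    ... | inj₁ q = fromRemoved q
    ... | inj₂ l = l

    widen : ∀ {W v x y} → EdgeIn G (W - v) x y → EdgeIn G W x y
    widen {W} (x∈ , y∈ , e) = p─q⊆p W _ x∈ , p─q⊆p W _ y∈ , e

    connected? : ∀ W → Acc _⊂_ W → ∀ v w → Dec (Star (EdgeIn G W) v w)
    connected? W (acc rec) v w with v ≟ w
    ... | yes refl = yes ε
    ... | no v≢w with v ∈? W
    ...   | no v∉W = no λ { ε → v≢w refl ; ((v∈W , _) ◅ _) → v∉W v∈W }
    ...   | yes v∈W = map′ to from
      (any? λ y → (v ~? y) ×-dec ((y ∈? (W - v)) ×-dec
                  connected? (W - v) (rec (x∈p⇒p-x⊂p v∈W)) y w))
      where
      to : ∃[ y ] (v ~ y × y ∈ W - v × Star (EdgeIn G (W - v)) y w) → Star (EdgeIn G W) v w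
      to (y , v~y , y∈ , p) = (v∈W , p─q⊆p W _ y∈ , v~y) ◅ gmap id widen p

      from : Star (EdgeIn G W) v w → ∃[ y ] (v ~ y × y ∈ W - v × Star (EdgeIn G (W - v)) y w)
      from p with leaves p
      ... | inj₁ v≡w = ⊥-elim (v≢w v≡w)
      ... | inj₂ r   = r

  sameComponent? : ∀ W x y → Dec (SameComponent G W x y)
  sameComponent? W x y =
    (x ∈? W) ×-dec ((y ∈? W) ×-dec connected? W (⊂-wellFounded W) x y)

  psdRule? : ∀ B u v → Dec (psdRule G B u v)
  psdRule? B u v =
    (u ~? v) ×-dec all? λ w → sameComponent? (∁ B) v w →-dec ((u ~? w) →-dec (w ≟ v))

module _ {R : Rule n} (R? : ∀ B u v → Dec (R B u v)) where

  step? : ∀ B B′ → Dec (Step R B B′)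
  step? B B′ with B ⊆? B′
  ... | no  B⊈B′ = no (B⊈B′ ∘ Step.stay-blue)
  ... | yes B⊆B′ = map′ (step B⊆B′) Step.newly-forced
    (all? λ v → (v ∈? B′) →-dec (¬? (v ∈? B) →-dec
      any? λ u → (u ∈? B) ×-dec R? B u v))

  private
    Progress : Subset n → Set
    Progress B = ∃[ B′ ] (B ⊂ B′ × Step R B B′ × ForcingSet R B′)

    progress : ∀ {B} → ForcingSet R B → ⊤ ⊆ B ⊎ Progress B
    progress ε = inj₁ id
    progress {B} (_◅_ {j = B′} s p) with B′ ⊆? B
    ... | yes B′⊆B with ⊆-antisym B′⊆B (Step.stay-blue s)
    ...   | refl = progress p
    progress {B} (_◅_ {j = B′} s p) | no B′⊈B with B ⊂? B′
    ... | yes B⊂B′ = inj₂ (B′ , B⊂B′ , s , p)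
    ... | no  B⊄B′ = ⊥-elim (B′⊈B below)
      where
      below : B′ ⊆ B
      below {x} x∈B′ with x ∈? B
      ... | yes x∈B = x∈B
      ... | no  x∉B = ⊥-elim (B⊄B′ (Step.stay-blue s , x , x∈B′ , x∉B))

    forcingSetAcc? : ∀ B → Acc _⊃_ B → Dec (ForcingSet R B)
    forcingSetAcc? B (acc rec) with ⊤ ⊆? B
    ... | yes ⊤⊆B = yes (subst (ForcingSet R) (⊆-antisym ⊤⊆B ⊆⊤) ε)
    ... | no  ⊤⊈B = map′ (λ (_ , _ , s , p) → s ◅ p) from (anySubset? next?)
      where
      next? : ∀ B′ → Dec (B ⊂ B′ × Step R B B′ × ForcingSet R B′)
      next? B′ with B ⊂? B′
      ... | no  B⊄B′ = no (B⊄B′ ∘ proj₁)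
      ... | yes B⊂B′ = map′ (B⊂B′ ,_) proj₂ (step? B B′ ×-dec forcingSetAcc? B′ (rec B⊂B′))

      from : ForcingSet R B → Progress B
      from p with progress p
      ... | inj₁ ⊤⊆B = ⊥-elim (⊤⊈B ⊤⊆B)
      ... | inj₂ q   = q

  forcingSet? : ∀ B → Dec (ForcingSet R B)
  forcingSet? B = forcingSetAcc? B (⊃-wellFounded B)

  private
    minimise : ∀ B → ForcingSet R B → Acc _<_ ∣ B ∣ → ∃ (IsForcingNumber R)
    minimise B f (acc rec) with anySubset? (λ C → forcingSet? C ×-dec (∣ C ∣ <? ∣ B ∣))
    ... | yes (C , g , C<B) = minimise C g (rec C<B)
    ... | no  none = ∣ B ∣ , (B , f , refl) , λ C g → ≮⇒≥ λ C<B → none (C , g , C<B)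

  -- Abstract only to keep the search from being unfolded.
  abstract
    forcingNumber : ∃ (IsForcingNumber R)
    forcingNumber = minimise ⊤ ε (<-wellFounded _)

Z : Graph n → ℕ
Z G = proj₁ (forcingNumber (standardRule? G))

Z₊ : Graph n → ℕ
Z₊ G = proj₁ (forcingNumber (psdRule? G))

Z₊Z-Perfect : Graph n → Set₁
Z₊Z-Perfect G = ∀ {m} (H : Graph m) → InducedSubgraph H G → Z₊ H ≡ Z H

{-# OPTIONS --safe #-}
module Submission where

-- In a claw-free graph, a positive semidefinite force u → v inside a white
-- component C leaves C - v connected: u is adjacent to no other vertex of C, so
-- two non-adjacent neighbours of v in C would form a claw with u.  Hence the white components C₁, …, Cₖ
-- of the initial blue set B never split, and a force u → v into Cᵢ can fail to
-- be a standard force only because u ∈ B is adjacent to another component Cⱼ.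
-- Replacing u by v for each force in Cᵢ up to that one gives a positive
-- semidefinite forcing set of the same size, in which u is white and enlarges
-- Cⱼ, while only Cᵢ has been destroyed.  If the large components weigh enough,
-- this increases the total weight whenever ∣Cᵢ∣ ≤ ∣Cⱼ∣.  So at maximal weight the
-- components can be exhausted by standard forces in order of increasing size.

open import Defs
open import Algebra.Properties.CommutativeSemigroup using (interchange; xy∙z≈xz∙y)
open import Data.Bool using (true; false)
open import Data.Empty using (⊥-elim)
open import Data.Fin using (Fin; zero; suc)
open import Data.Fin.Properties using (_≟_; any?)
open import Data.Fin.Subset using (Subset; _∈_; _∉_; _⊆_; _⊂_; _⊃_; _∪_; _-_; ∁; ⊤; ⁅_⁆; ∣_∣)
open import Data.Fin.Subset.Induction using (Acc; acc; ⊃-wellFounded)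
open import Data.Fin.Subset.Properties
open import Data.Nat using (ℕ; zero; suc; _+_; _*_; _^_; _∸_; _≤_; _<_; z≤n; s≤s)
open import Data.Nat.Induction using (<-wellFounded)
open import Data.Nat.Properties hiding (_≟_)
open import Data.Product using (∃; ∃-syntax; _×_; _,_; proj₁; proj₂)
open import Data.Sum using (_⊎_; inj₁; inj₂)
open import Data.Vec using (_∷_; []; there; tabulate)
open import Data.Vec.Properties using (lookup⇒[]=; []=⇒lookup; lookup∘tabulate)
open import Function using (_⇔_; mk⇔; _∘_; id; Equivalence)
open import Relation.Binary.Construct.Closure.ReflexiveTransitive
  using (Star; ε; _◅_; _◅◅_; gmap; fold; reverse)
open import Relation.Binary.PropositionalEquality
open import Relation.Nullary using (¬_; Dec; yes; no; does)
open import Relation.Nullary.Decidable using (dec-true; ¬?; _×-dec_; decidable-stable)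

private
  variable
    m n : ℕ

-- Finite subsets, minima and sums over `Fin n`.

module _ {P : Fin n → Set} (P? : ∀ x → Dec (P x)) where

  comprehension : Subset n
  comprehension = tabulate (λ x → does (P? x))

  ∈-comprehension⁺ : ∀ {x} → P x → x ∈ comprehension
  ∈-comprehension⁺ {x} px =
    lookup⇒[]= x _ (trans (lookup∘tabulate _ x) (dec-true (P? x) px))

  ∈-comprehension⁻ : ∀ {x} → x ∈ comprehension → P x
  ∈-comprehension⁻ {x} x∈ with P? x | trans (sym (lookup∘tabulate (λ y → does (P? y)) x)) ([]=⇒lookup x∈)
  ... | yes px | _ = px
  ... | no  _  | ()

x∉p-x : ∀ {p : Subset n} {x} → x ∉ p - x
x∉p-x {p = _ ∷ p} {zero} ()
x∉p-x {p = _ ∷ p} {suc x} (there x∈) = x∉p-x {p = p} x∈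

∣p∪⁅x⁆∣≤1+∣p∣ : ∀ (p : Subset n) x → ∣ p ∪ ⁅ x ⁆ ∣ ≤ suc ∣ p ∣
∣p∪⁅x⁆∣≤1+∣p∣ (true  ∷ p) zero    rewrite ∪-identityʳ p = n≤1+n _
∣p∪⁅x⁆∣≤1+∣p∣ (false ∷ p) zero    rewrite ∪-identityʳ p = ≤-refl
∣p∪⁅x⁆∣≤1+∣p∣ (true  ∷ p) (suc x) = s≤s (∣p∪⁅x⁆∣≤1+∣p∣ p x)
∣p∪⁅x⁆∣≤1+∣p∣ (false ∷ p) (suc x) = ∣p∪⁅x⁆∣≤1+∣p∣ p x

x∈p∪⁅x⁆ : ∀ (p : Subset n) x → x ∈ p ∪ ⁅ x ⁆
x∈p∪⁅x⁆ p x = q⊆p∪q p _ (x∈⁅x⁆ x)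

y∈p∪⁅x⁆⁻ : ∀ (p : Subset n) x {y} → y ∈ p ∪ ⁅ x ⁆ → y ∈ p ⊎ y ≡ x
y∈p∪⁅x⁆⁻ p x y∈ with x∈p∪q⁻ p ⁅ x ⁆ y∈
... | inj₁ y∈p = inj₁ y∈p
... | inj₂ y∈x = inj₂ (x∈⁅y⁆⇒x≡y x y∈x)

least : ∀ {P : Fin n → Set} → (∀ x → Dec (P x)) → (f : Fin n → ℕ) → ∃ P →
        ∃[ x ] (P x × (∀ y → P y → f x ≤ f y))
least {P = P} P? f (x₀ , px₀) = search x₀ px₀ (<-wellFounded _)
  where
  search : ∀ x → P x → Acc _<_ (f x) → ∃[ x ] (P x × (∀ y → P y → f x ≤ f y))
  search x px (acc rec) with any? (λ y → P? y ×-dec (f y <? f x))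
  ... | yes (y , py , fy<fx) = search y py (rec fy<fx)
  ... | no  none = x , px , λ y py → ≮⇒≥ λ fy<fx → none (y , py , fy<fx)

∑ : (Fin n → ℕ) → ℕ
∑ {zero}  f = 0
∑ {suc n} f = f zero + ∑ (f ∘ suc)

∑-≤ : ∀ {k} {f g : Fin n → ℕ} → (∀ i → f i ≤ k + g i) → ∑ f ≤ n * k + ∑ g
∑-≤ {zero} f≤g = z≤n
∑-≤ {suc n} {k} {f} {g} f≤g = begin
  f zero + ∑ (f ∘ suc)                   ≤⟨ +-mono-≤ (f≤g zero) (∑-≤ (f≤g ∘ suc)) ⟩
  (k + g zero) + (n * k + ∑ (g ∘ suc))   ≡⟨ interchange +-commutativeSemigroup k _ _ _ ⟩
  suc n * k + ∑ g                        ∎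
  where
  open ≤-Reasoning

-- A loss of `k` is allowed at every index, `u` included; a surplus `K` at the single index `u`
-- survives in the total.
∑-≤-at : ∀ {k K} {f g : Fin n → ℕ} u → (∀ i → f i ≤ k + g i) → f u + K ≤ k + g u →
         ∑ f + K ≤ n * k + ∑ g
∑-≤-at {suc n} {k} {K} {f} {g} zero f≤g fu≤gu = begin
  (f zero + ∑ (f ∘ suc)) + K             ≡⟨ xy∙z≈xz∙y +-commutativeSemigroup (f zero) _ _ ⟩
  (f zero + K) + ∑ (f ∘ suc)             ≤⟨ +-mono-≤ fu≤gu (∑-≤ (f≤g ∘ suc)) ⟩
  (k + g zero) + (n * k + ∑ (g ∘ suc))   ≡⟨ interchange +-commutativeSemigroup k _ _ _ ⟩
  suc n * k + ∑ g                        ∎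
  where
  open ≤-Reasoning
∑-≤-at {suc n} {k} {K} {f} {g} (suc u) f≤g fu≤gu = begin
  (f zero + ∑ (f ∘ suc)) + K             ≡⟨ +-assoc (f zero) _ _ ⟩
  f zero + (∑ (f ∘ suc) + K)             ≤⟨ +-mono-≤ (f≤g zero) (∑-≤-at u (f≤g ∘ suc) fu≤gu) ⟩
  (k + g zero) + (n * k + ∑ (g ∘ suc))   ≡⟨ interchange +-commutativeSemigroup k _ _ _ ⟩
  suc n * k + ∑ g                        ∎
  where
  open ≤-Reasoning

-- Induced subgraphs and closure under forcing.

InducedSubgraph-trans : ∀ {k} {F : Graph k} {H : Graph m} {G : Graph n} →
                        InducedSubgraph F H → InducedSubgraph H G → InducedSubgraph F G
InducedSubgraph-trans F≤H H≤G = record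
  { embed           = H≤G.embed ∘ F≤H.embed
  ; embed-injective = F≤H.embed-injective ∘ H≤G.embed-injective
  ; embed-adjacent  = λ u v → mk⇔
      (Equivalence.to   (H≤G.embed-adjacent _ _) ∘ Equivalence.to   (F≤H.embed-adjacent u v))
      (Equivalence.from (F≤H.embed-adjacent u v) ∘ Equivalence.from (H≤G.embed-adjacent _ _))
  }
  where
  module F≤H = InducedSubgraph F≤H
  module H≤G = InducedSubgraph H≤G

step-one : ∀ {R : Rule n} {B u v} → u ∈ B → R B u v → Step R B (B ∪ ⁅ v ⁆)
step-one {B = B} {u} {v} u∈B r = step (p⊆p∪q ⁅ v ⁆) λ w w∈ w∉B → newly w∉B (y∈p∪⁅x⁆⁻ B v w∈)
  where
  newly : ∀ {w} → w ∉ B → w ∈ B ⊎ w ≡ v → ∃[ u ] (u ∈ B × _)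
  newly w∉B (inj₁ w∈B)  = ⊥-elim (w∉B w∈B)
  newly w∉B (inj₂ refl) = u , u∈B , r

missing-or-⊤ : (B : Subset n) → (∃[ x ] x ∉ B) ⊎ B ≡ ⊤
missing-or-⊤ B with any? (λ x → ¬? (x ∈? B))
... | yes x∉B  = inj₁ x∉B
... | no  none = inj₂ (⊆-antisym ⊆⊤ λ {x} _ → decidable-stable (x ∈? B) λ x∉B → none (x , x∉B))

module _ {R : Rule n} (R? : ∀ B u v → Dec (R B u v)) where

  Stuck : Subset n → Set
  Stuck B = ∀ u v → u ∈ B → v ∉ B → ¬ R B u v

  -- Each single force strictly enlarges the blue set, so the forces run out.
  closure : ∀ B → ∃[ S ] (Star (Step R) B S × B ⊆ S × Stuck S)
  closure B = grow B (⊃-wellFounded B)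
    where
    grow : ∀ B → Acc _⊃_ B → ∃[ S ] (Star (Step R) B S × B ⊆ S × Stuck S)
    grow B (acc rec) with any? (λ u → any? λ v → (u ∈? B) ×-dec (¬? (v ∈? B) ×-dec R? B u v))
    ... | no none = B , ε , id , λ u v u∈B v∉B r → none (u , v , u∈B , v∉B , r)
    ... | yes (u , v , u∈B , v∉B , r)
      with grow (B ∪ ⁅ v ⁆) (rec (p⊆p∪q ⁅ v ⁆ , v , x∈p∪⁅x⁆ B v , v∉B))
    ...   | S , p , ⊆S , stuck = S , step-one {R = R} u∈B r ◅ p , ⊆S ∘ p⊆p∪q ⁅ v ⁆ , stuck

-- Claws and detours around a vertex.

module _ (G : Graph n) where
  open Graph G

  ~⇒≢ : ∀ {u v} → u ~ v → u ≢ v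
  ~⇒≢ u~v refl = ~-irrefl u~v

  claw : ∀ {c} (leaf : Fin 3 → Fin n) → (∀ i → c ~ leaf i) → (∀ i j → ¬ leaf i ~ leaf j) →
         (∀ {i j} → leaf i ≡ leaf j → i ≡ j) → InducedSubgraph K₁,₃ G
  claw {c} leaf c~ leaf≁ leaf-inj = record
    { embed           = embed
    ; embed-injective = λ {i} {j} → inj i j
    ; embed-adjacent  = λ i j → mk⇔ to (from i j)
    }
    where
    embed : Fin 4 → Fin n
    embed zero    = c
    embed (suc i) = leaf i
    inj : ∀ i j → embed i ≡ embed j → i ≡ j
    inj zero    zero    _  = refl
    inj zero    (suc j) eq = ⊥-elim (~⇒≢ (c~ j) eq)
    inj (suc i) zero    eq = ⊥-elim (~⇒≢ (c~ i) (sym eq))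
    inj (suc i) (suc j) eq = cong suc (leaf-inj eq)
    to : ∀ {i j} → ClawEdge i j → embed i ~ embed j
    to (out i) = c~ i
    to (inn i) = ~-sym (c~ i)
    from : ∀ i j → embed i ~ embed j → ClawEdge i j
    from zero    zero    e = ⊥-elim (~-irrefl e)
    from zero    (suc j) e = out j
    from (suc i) zero    e = inn i
    from (suc i) (suc j) e = ⊥-elim (leaf≁ i j e)

  -- Otherwise `c` with the leaves `u`, `p`, `q` would be an induced claw.
  clawFree-adjacent : ClawFree G → ∀ {c u p q} → c ~ u → c ~ p → c ~ q →
                      u ≢ p → u ≢ q → p ≢ q → ¬ u ~ p → ¬ u ~ q → p ~ q
  clawFree-adjacent cf {c} {u} {p} {q} c~u c~p c~q u≢p u≢q p≢q u≁p u≁q =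
    decidable-stable (p ~? q) λ p≁q → cf (claw leaf
      (λ { zero → c~u ; (suc zero) → c~p ; (suc (suc zero)) → c~q })
      (leaf≁ p≁q) (λ {i} {j} → inj i j))
    where
    leaf : Fin 3 → Fin n
    leaf zero             = u
    leaf (suc zero)       = p
    leaf (suc (suc zero)) = q
    leaf≁ : ¬ p ~ q → ∀ i j → ¬ leaf i ~ leaf j
    leaf≁ p≁q zero             zero             = ~-irrefl
    leaf≁ p≁q zero             (suc zero)       = u≁p
    leaf≁ p≁q zero             (suc (suc zero)) = u≁q
    leaf≁ p≁q (suc zero)       zero             = u≁p ∘ ~-sym
    leaf≁ p≁q (suc zero)       (suc zero)       = ~-irrefl
    leaf≁ p≁q (suc zero)       (suc (suc zero)) = p≁q
    leaf≁ p≁q (suc (suc zero)) zero             = u≁q ∘ ~-sym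
    leaf≁ p≁q (suc (suc zero)) (suc zero)       = p≁q ∘ ~-sym
    leaf≁ p≁q (suc (suc zero)) (suc (suc zero)) = ~-irrefl
    inj : ∀ i j → leaf i ≡ leaf j → i ≡ j
    inj zero             zero             eq = refl
    inj zero             (suc zero)       eq = ⊥-elim (u≢p eq)
    inj zero             (suc (suc zero)) eq = ⊥-elim (u≢q eq)
    inj (suc zero)       zero             eq = ⊥-elim (u≢p (sym eq))
    inj (suc zero)       (suc zero)       eq = refl
    inj (suc zero)       (suc (suc zero)) eq = ⊥-elim (p≢q eq)
    inj (suc (suc zero)) zero             eq = ⊥-elim (u≢q (sym eq))
    inj (suc (suc zero)) (suc zero)       eq = ⊥-elim (p≢q (sym eq))
    inj (suc (suc zero)) (suc (suc zero)) eq = refl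

  EdgeIn-mono : ∀ {V W x y} → V ⊆ W → EdgeIn G V x y → EdgeIn G W x y
  EdgeIn-mono V⊆W (x∈ , y∈ , e) = V⊆W x∈ , V⊆W y∈ , e

  EdgeIn-sym : ∀ {W x y} → EdgeIn G W x y → EdgeIn G W y x
  EdgeIn-sym (x∈ , y∈ , e) = y∈ , x∈ , ~-sym e

  module _ {V W : Subset n} {v : Fin n}
           (keep : ∀ {y} → y ∈ W → y ≢ v → y ∈ V)
           (clique : ∀ {p q} → p ∈ W → q ∈ W → v ~ p → v ~ q → p ≢ q → p ~ q) where

    mutual
      -- Each visit to `v` enters from a neighbour `p` and leaves to a neighbour `q`; these are
      -- equal or adjacent, so the visit can be cut out.
      bypass : ∀ {x y} → x ≢ v → y ≢ v → Star (EdgeIn G W) x y → Star (EdgeIn G V) x y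
      bypass x≢v y≢v ε = ε
      bypass x≢v y≢v (_◅_ {j = z} (x∈ , z∈ , x~z) p) with z ≟ v
      ... | yes refl = bypass-from x∈ x≢v x~z y≢v p
      ... | no  z≢v  = (keep x∈ x≢v , keep z∈ z≢v , x~z) ◅ bypass z≢v y≢v p

      bypass-from : ∀ {p y} → p ∈ W → p ≢ v → p ~ v → y ≢ v →
                    Star (EdgeIn G W) v y → Star (EdgeIn G V) p y
      bypass-from p∈ p≢v p~v y≢v ε = ⊥-elim (y≢v refl)
      bypass-from {p} p∈ p≢v p~v y≢v (_◅_ {j = q} (v∈ , q∈ , v~q) path)
        with p ≟ q
      ... | yes refl = bypass p≢v y≢v path
      ... | no  p≢q  = (keep p∈ p≢v , keep q∈ q≢v , clique p∈ q∈ (~-sym p~v) v~q p≢q)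
                       ◅ bypass q≢v y≢v path
        where
        q≢v : q ≢ v
        q≢v = ~⇒≢ v~q ∘ sym

  -- Monotonicity and comparison of the two rules.

  psdRule-mono : ∀ {B B′ u v} → B ⊆ B′ → psdRule G B u v → psdRule G B′ u v
  psdRule-mono B⊆B′ (u~v , only) =
    u~v , λ w (v∈ , w∈ , p) → only w (∁⊆ v∈ , ∁⊆ w∈ , gmap id (EdgeIn-mono ∁⊆) p)
    where ∁⊆ = p⊆q⇒∁p⊇∁q B⊆B′

  -- The original steps are replayed with `B′` added to every blue set: white components only
  -- shrink, and forces onto vertices that are already blue are dropped.
  psdForcing-mono : ∀ {B B′} → B ⊆ B′ → ForcingSet (psdRule G) B → ForcingSet (psdRule G) B′
  psdForcing-mono {B′ = B′} B⊆B′ ε = subst (ForcingSet (psdRule G)) (⊆-antisym B⊆B′ ⊆⊤) ε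
  psdForcing-mono {B} {B′} B⊆B′ (_◅_ {j = C} (step _ newly) p) =
    step (p⊆p∪q C) newly′ ◅ psdForcing-mono (q⊆p∪q B′ C) p
    where
    newly′ : ∀ v → v ∈ B′ ∪ C → v ∉ B′ → ∃[ u ] (u ∈ B′ × psdRule G B′ u v)
    newly′ v v∈ v∉B′ with x∈p∪q⁻ B′ C v∈
    ... | inj₁ v∈B′ = ⊥-elim (v∉B′ v∈B′)
    ... | inj₂ v∈C with newly v v∈C (v∉B′ ∘ B⊆B′)
    ...   | u , u∈B , r = u , B⊆B′ u∈B , psdRule-mono B⊆B′ r

  -- A unique white neighbour in the whole graph is also unique in its component.
  standard⇒psd : ∀ {B} → ForcingSet (standardRule G) B → ForcingSet (psdRule G) B
  standard⇒psd = gmap id λ (step stay newly) → step stay λ v v∈ v∉ →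
    let u , u∈B , u~v , only = newly v v∈ v∉
    in u , u∈B , u~v , λ w (_ , w∈∁B , _) u~w → only w (x∈∁p⇒x∉p w∈∁B) u~w

  -- White components and the forces inside them.

  component : Subset n → Fin n → Subset n
  component B x = comprehension (sameComponent? G (∁ B) x)

  ∈-component⁺ : ∀ B {x y} → SameComponent G (∁ B) x y → y ∈ component B x
  ∈-component⁺ B {x} = ∈-comprehension⁺ (sameComponent? G (∁ B) x)

  ∈-component⁻ : ∀ B {x y} → y ∈ component B x → SameComponent G (∁ B) x y
  ∈-component⁻ B {x} = ∈-comprehension⁻ (sameComponent? G (∁ B) x)

  module _ {B : Subset n} where

    private
      Comp = SameComponent G (∁ B)

    Comp-refl : ∀ {x} → x ∉ B → Comp x x
    Comp-refl x∉B = x∉p⇒x∈∁p x∉B , x∉p⇒x∈∁p x∉B , ε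

    Comp-white : ∀ {x y} → Comp x y → y ∉ B
    Comp-white (_ , y∈ , _) = x∈∁p⇒x∉p y∈

    Comp-sym : ∀ {x y} → Comp x y → Comp y x
    Comp-sym (x∈ , y∈ , p) = y∈ , x∈ , reverse EdgeIn-sym p

    Comp-trans : ∀ {x y z} → Comp x y → Comp y z → Comp x z
    Comp-trans (x∈ , _ , p) (_ , z∈ , q) = x∈ , z∈ , p ◅◅ q

    Comp-extend : ∀ {x y z} → Comp x y → y ~ z → z ∉ B → Comp x z
    Comp-extend (x∈ , y∈ , p) y~z z∉B =
      x∈ , x∉p⇒x∈∁p z∉B , p ◅◅ ((y∈ , x∉p⇒x∈∁p z∉B , y~z) ◅ ε)

    -- A force from B or from inside the component remains valid when only the
    -- part of the later blue set that lies in the component is retained.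
    nextForce : ∀ {A x y} → B ⊆ A → ForcingSet (psdRule G) B → Comp x y → y ∉ A →
                ∃[ u ] ∃[ v ] (u ∈ A × v ∉ A × Comp x v × psdRule G A u v)
    nextForce {A} {x} {y} B⊆A forcing xCy y∉A = walk (λ z∈B xCz → ⊥-elim (Comp-white xCz z∈B)) id forcing
      where
      -- Invariant: within the component of `x`, the blue set `D` of the original process has not
      -- gone beyond `A`. The first step that breaks it contains the required force.
      walk : ∀ {D} → (∀ {z} → z ∈ D → Comp x z → z ∈ A) → B ⊆ D → ForcingSet (psdRule G) D →
             ∃[ u ] ∃[ v ] (u ∈ A × v ∉ A × Comp x v × psdRule G A u v)
      walk D⊆A B⊆D ε = ⊥-elim (y∉A (D⊆A ∈⊤ xCy))
      walk {D} D⊆A B⊆D (_◅_ {j = E} (step stay newly) p)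
        with any? (λ v → (v ∈? E) ×-dec (¬? (v ∈? A) ×-dec sameComponent? G (∁ B) x v))
      ... | no none = walk (λ {z} z∈E xCz → decidable-stable (z ∈? A) λ z∉A → none (z , z∈E , z∉A , xCz))
                           (stay ∘ B⊆D) p
      ... | yes (v , v∈E , v∉A , xCv) with newly v v∈E (λ v∈D → v∉A (D⊆A v∈D xCv))
      ...   | u , u∈D , u~v , only = u , v , u∈A , v∉A , xCv , u~v , only′
        where
        u∈A : u ∈ A
        u∈A with u ∈? B
        ... | yes u∈B = B⊆A u∈B
        ... | no  u∉B = D⊆A u∈D (Comp-extend xCv (~-sym u~v) u∉B)
        ∁A⊆∁D : ∀ {z} → z ∈ ∁ A → Comp x z → z ∈ ∁ D
        ∁A⊆∁D z∈ xCz = x∉p⇒x∈∁p λ z∈D → x∈∁p⇒x∉p z∈ (D⊆A z∈D xCz)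
        -- A path that avoids `A` also avoids `B`, so it never leaves the component of `x`, where
        -- white for `A` implies white for `D`.
        narrow : ∀ {z w} → Comp x z → Star (EdgeIn G (∁ A)) z w → Comp x w × Star (EdgeIn G (∁ D)) z w
        narrow xCz ε = xCz , ε
        narrow xCz ((z∈ , t∈ , z~t) ◅ q) =
          let xCt = Comp-extend xCz z~t (x∈∁p⇒x∉p t∈ ∘ B⊆A)
              xCw , q′ = narrow xCt q
          in xCw , (∁A⊆∁D z∈ xCz , ∁A⊆∁D t∈ xCt , z~t) ◅ q′
        only′ : ∀ w → SameComponent G (∁ A) v w → u ~ w → w ≡ v
        only′ w (v∈ , w∈ , q) u~w =
          let xCw , q′ = narrow xCv q
          in only w (∁A⊆∁D v∈ xCv , ∁A⊆∁D w∈ xCw , q′) u~w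

  -- Replacing forcing vertices by the vertices they force.

  -- Forces inside the white component of x, starting from the blue set B,
  -- have made the set A blue; M is the set obtained from B when every
  -- force u → v replaces u by v.
  record Migration (B : Subset n) (x : Fin n) (A M : Subset n) : Set where
    field
      B⊆A       : B ⊆ A
      A⊆        : ∀ {a} → a ∈ A → a ∉ B → SameComponent G (∁ B) x a
      M⊆A       : M ⊆ A
      ∣M∣≤∣B∣   : ∣ M ∣ ≤ ∣ B ∣
      M-forcing : ForcingSet (psdRule G) M
      spent     : ∀ {a y} → a ∈ A → a ∉ M → SameComponent G (∁ B) x y → y ∉ A → ¬ a ~ y
      connected : ∀ {y z} → SameComponent G (∁ B) x y → SameComponent G (∁ B) x z →
                  y ∉ A → z ∉ A → Star (EdgeIn G (∁ A)) y z

  start : ∀ {B x} → ForcingSet (psdRule G) B → Migration B x B B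
  start forcing = record
    { B⊆A = id ; A⊆ = λ a∈B a∉B → ⊥-elim (a∉B a∈B) ; M⊆A = id ; ∣M∣≤∣B∣ = ≤-refl
    ; M-forcing = forcing ; spent = λ a∈B a∉B → ⊥-elim (a∉B a∈B)
    ; connected = λ xCy xCz _ _ → proj₂ (proj₂ (Comp-trans (Comp-sym xCy) xCz)) }

  module _ (cf : ClawFree G) {B : Subset n} {x : Fin n} {A M : Subset n} (μ : Migration B x A M)
           {u v : Fin n} (u∈A : u ∈ A) (v∉A : v ∉ A) (xCv : SameComponent G (∁ B) x v)
           (force : psdRule G A u v) where
    open Migration μ

    private
      u~v = proj₁ force
      A′  = A ∪ ⁅ v ⁆
      M′  = (M - u) ∪ ⁅ v ⁆

      ∉A : ∀ {y} → y ∉ A′ → y ∉ A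
      ∉A y∉ = y∉ ∘ p⊆p∪q ⁅ v ⁆

      ∉A′ : ∀ {y} → y ∉ A → y ≢ v → y ∉ A′
      ∉A′ y∉A y≢v y∈A′ with y∈p∪⁅x⁆⁻ A v y∈A′
      ... | inj₁ y∈A = y∉A y∈A
      ... | inj₂ y≡v = y≢v y≡v

      -- By `connected`, the unforced part of the component of `x` lies in one white component of
      -- `A`, so the rule for `u` and `v` speaks about all of it.
      u≁ : ∀ {y} → SameComponent G (∁ B) x y → y ∉ A → y ≢ v → ¬ u ~ y
      u≁ xCy y∉A y≢v u~y =
        y≢v (proj₂ force _ (x∉p⇒x∈∁p v∉A , x∉p⇒x∈∁p y∉A , connected xCv xCy v∉A y∉A) u~y)

      -- A vertex replaced earlier has no unforced neighbour left, but `v` is one of `u`.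
      u∈M : u ∈ M
      u∈M = decidable-stable (u ∈? M) λ u∉M → spent u∈A u∉M xCv v∉A u~v

      ∈M′ : ∀ {y} → y ∈ M → y ≢ u → y ∈ M′
      ∈M′ y∈M y≢u = p⊆p∪q ⁅ v ⁆ (x∈p∧x≢y⇒x∈p-y y∈M y≢u)

    replaced : u ∉ M′
    replaced u∈M′ with y∈p∪⁅x⁆⁻ (M - u) v u∈M′
    ... | inj₁ u∈M-u = x∉p-x {p = M} u∈M-u
    ... | inj₂ refl  = v∉A u∈A

    private
      spent′ : ∀ {a y} → a ∈ A′ → a ∉ M′ → SameComponent G (∁ B) x y → y ∉ A′ → ¬ a ~ y
      spent′ {a} {y} a∈A′ a∉M′ xCy y∉A′ with y∈p∪⁅x⁆⁻ A v a∈A′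
      ... | inj₂ refl = ⊥-elim (a∉M′ (x∈p∪⁅x⁆ (M - u) v))
      ... | inj₁ a∈A with a ≟ u
      ...   | yes refl = u≁ xCy (∉A y∉A′) λ { refl → y∉A′ (x∈p∪⁅x⁆ A v) }
      ...   | no  a≢u  = spent a∈A (λ a∈M → a∉M′ (∈M′ a∈M a≢u)) xCy (∉A y∉A′)

      -- Two white neighbours of v and the vertex u are no claw at v.
      connected′ : ∀ {y z} → SameComponent G (∁ B) x y → SameComponent G (∁ B) x z →
                   y ∉ A′ → z ∉ A′ → Star (EdgeIn G (∁ A′)) y z
      connected′ xCy xCz y∉A′ z∉A′ =
        bypass (λ y∈ y≢v → x∉p⇒x∈∁p (∉A′ (x∈∁p⇒x∉p y∈) y≢v)) clique (≢v y∉A′) (≢v z∉A′)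
               (connected xCy xCz (∉A y∉A′) (∉A z∉A′))
        where
        ≢v : ∀ {y} → y ∉ A′ → y ≢ v
        ≢v y∉A′ refl = y∉A′ (x∈p∪⁅x⁆ A v)
        clique : ∀ {p q} → p ∈ ∁ A → q ∈ ∁ A → v ~ p → v ~ q → p ≢ q → p ~ q
        clique p∈ q∈ v~p v~q p≢q =
          clawFree-adjacent cf (~-sym u~v) v~p v~q (u≢ p∈) (u≢ q∈) p≢q (apart p∈ v~p) (apart q∈ v~q)
          where
          u≢ : ∀ {p} → p ∈ ∁ A → u ≢ p
          u≢ p∈ refl = x∈∁p⇒x∉p p∈ u∈A
          apart : ∀ {p} → p ∈ ∁ A → v ~ p → ¬ u ~ p
          apart p∈ v~p = u≁ (Comp-extend xCv v~p (x∈∁p⇒x∉p p∈ ∘ B⊆A)) (x∈∁p⇒x∉p p∈) (~⇒≢ v~p ∘ sym)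

      -- After the replacement v can force u back: the rest of the component
      -- of x is no longer joined to u by white vertices.
      back : psdRule G M′ v u
      back = ~-sym u~v , only
        where
        -- Invariant along a white path from `u`: no vertex on it belongs to the unforced rest of
        -- the component of `x`. Entering that rest from `A′` would contradict `spent′`.
        Away : Fin n → Set
        Away z = z ∉ A′ → ¬ SameComponent G (∁ B) x z
        away : ∀ {y z} → EdgeIn G (∁ M′) y z → Away y → Away z
        away {y} (y∈ , z∈ , y~z) ay z∉A′ xCz with y ∈? A′
        ... | yes y∈A′ = spent′ y∈A′ (x∈∁p⇒x∉p y∈) xCz z∉A′ y~z
        ... | no  y∉A′ = ay y∉A′ (Comp-extend xCz (~-sym y~z) (∉A y∉A′ ∘ B⊆A))
        only : ∀ w → SameComponent G (∁ M′) u w → v ~ w → w ≡ u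
        only w (_ , w∈ , p) v~w with w ∈? A′
        ... | no w∉A′ = ⊥-elim (fold (λ y z → Away y → Away z) (λ e k a → k (away e a)) id p
                                  (λ u∉A′ → ⊥-elim (∉A u∉A′ u∈A)) w∉A′
                                  (Comp-extend xCv v~w (∉A w∉A′ ∘ B⊆A)))
        ... | yes w∈A′ with y∈p∪⁅x⁆⁻ A v w∈A′
        ...   | inj₂ refl = ⊥-elim (~-irrefl v~w)
        -- Any other such `w` was replaced before `u`, at which time `v` was still unforced.
        ...   | inj₁ w∈A  = decidable-stable (w ≟ u) λ w≢u →
          spent w∈A (λ w∈M → x∈∁p⇒x∉p w∈ (∈M′ w∈M w≢u)) xCv v∉A (~-sym v~w)

    -- Exchanging `u` for `v` does not increase the size. Once `v` has forced `u` back, the blue set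
    -- contains `M`, and monotonicity finishes the forcing.
    migrate : Migration B x A′ M′
    migrate = record
      { B⊆A       = p⊆p∪q ⁅ v ⁆ ∘ B⊆A
      ; A⊆        = A⊆′
      ; M⊆A       = M′⊆A′
      ; ∣M∣≤∣B∣   = ≤-trans (∣p∪⁅x⁆∣≤1+∣p∣ (M - u) v) (≤-trans (x∈p⇒∣p-x∣<∣p∣ u∈M) ∣M∣≤∣B∣)
      ; M-forcing = step-one {R = psdRule G} (x∈p∪⁅x⁆ (M - u) v) back ◅ psdForcing-mono M⊆ M-forcing
      ; spent     = spent′
      ; connected = connected′
      }
      where
      A⊆′ : ∀ {a} → a ∈ A′ → a ∉ B → SameComponent G (∁ B) x a
      A⊆′ a∈A′ a∉B with y∈p∪⁅x⁆⁻ A v a∈A′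
      ... | inj₁ a∈A  = A⊆ a∈A a∉B
      ... | inj₂ refl = xCv
      M′⊆A′ : M′ ⊆ A′
      M′⊆A′ y∈M′ with y∈p∪⁅x⁆⁻ (M - u) v y∈M′
      ... | inj₁ y∈   = p⊆p∪q ⁅ v ⁆ (M⊆A (p─q⊆p M _ y∈))
      ... | inj₂ refl = x∈p∪⁅x⁆ A v
      M⊆ : M ⊆ M′ ∪ ⁅ u ⁆
      M⊆ {y} y∈M with y ≟ u
      ... | yes refl = x∈p∪⁅x⁆ M′ u
      ... | no  y≢u  = p⊆p∪q ⁅ u ⁆ (∈M′ y∈M y≢u)

  -- The potential and its growth.

  -- The base is chosen so that n vertices in components of size s weigh less
  -- than a single vertex in a component of size s + 1.
  weight : Subset n → Fin n → ℕ
  weight B z = suc n ^ ∣ component B z ∣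

  potential : Subset n → ℕ
  potential B = ∑ (weight B)

  -- The zero sum is kept so that this is literally the bound given by `∑-≤` with `g` zero.
  potentialBound : ℕ
  potentialBound = n * suc n ^ n + ∑ {n} (λ _ → 0)

  potential≤ : ∀ B → potential B ≤ potentialBound
  potential≤ B = ∑-≤ λ z → ≤-trans (^-monoʳ-≤ (suc n) (∣p∣≤n (component B z))) (m≤m+n _ 0)

  module _ {B : Subset n} {x : Fin n} {A M : Subset n} (μ : Migration B x A M)
           {u w : Fin n} (u∈B : u ∈ B) (u∉M : u ∉ M) (u~w : u ~ w) (w∉B : w ∉ B)
           (¬xCw : ¬ SameComponent G (∁ B) x w)
           (x≤w : ∣ component B x ∣ ≤ ∣ component B w ∣) where
    open Migration μ

    private
      -- `M` lies in `A`, which adds to `B` only vertices of the component of `x`.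
      white-stays : ∀ {z} → z ∉ B → ¬ SameComponent G (∁ B) x z → z ∉ M
      white-stays z∉B ¬xCz z∈M = ¬xCz (A⊆ (M⊆A z∈M) z∉B)

      component-stays : ∀ {y z} → ¬ SameComponent G (∁ B) x y →
                        SameComponent G (∁ B) y z → SameComponent G (∁ M) y z
      component-stays {y} ¬xCy yCz@(y∈ , z∈ , p) =
        ∈∁M y∈ ¬xCy , ∈∁M z∈ (¬xCy ∘ λ xCz → Comp-trans xCz (Comp-sym yCz)) , walk ¬xCy p
        where
        ∈∁M : ∀ {z} → z ∈ ∁ B → ¬ SameComponent G (∁ B) x z → z ∈ ∁ M
        ∈∁M z∈ ¬xCz = x∉p⇒x∈∁p (white-stays (x∈∁p⇒x∉p z∈) ¬xCz)
        walk : ∀ {y z} → ¬ SameComponent G (∁ B) x y → Star (EdgeIn G (∁ B)) y z → Star (EdgeIn G (∁ M)) y z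
        walk ¬xCy ε = ε
        walk ¬xCy ((y∈ , t∈ , y~t) ◅ p) = (∈∁M y∈ ¬xCy , ∈∁M t∈ ¬xCt , y~t) ◅ walk ¬xCt p
          where
          ¬xCt = λ xCt → ¬xCy (Comp-extend xCt (~-sym y~t) (x∈∁p⇒x∉p y∈))

      component-mono : ∀ {C D : Subset n} {y z} →
        (∀ {t} → SameComponent G (∁ C) y t → SameComponent G (∁ D) z t) →
        component C y ⊆ component D z
      component-mono {C} {D} f = ∈-component⁺ D ∘ f ∘ ∈-component⁻ C

      -- This bounds every possible loss: blue vertices have an empty component, the component of
      -- `x` is no larger than that of `w`, and all other white vertices lose nothing.
      k = weight B w

      1≤k : 1 ≤ k
      1≤k = m^n>0 (suc n) ∣ component B w ∣

      weight-blue : ∀ {z} → z ∈ B → weight B z ≤ k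
      weight-blue {z} z∈B = ^-monoʳ-≤ (suc n) (p⊆q⇒∣p∣≤∣q∣ {p = component B z} {q = component B w} λ t∈ →
        ⊥-elim (x∈p⇒x∉∁p z∈B (proj₁ (∈-component⁻ B t∈))))

      weight-≤ : ∀ z → weight B z ≤ k + weight M z
      weight-≤ z with z ∈? B
      ... | yes z∈B = m≤n⇒m≤n+o _ (weight-blue z∈B)
      ... | no  z∉B with sameComponent? G (∁ B) x z
      ...   | yes xCz = m≤n⇒m≤n+o _ (^-monoʳ-≤ (suc n) (≤-trans
                (p⊆q⇒∣p∣≤∣q∣ (component-mono {C = B} {D = B} (Comp-trans xCz))) x≤w))
      ...   | no ¬xCz = m≤n⇒m≤o+n k (^-monoʳ-≤ (suc n)
                (p⊆q⇒∣p∣≤∣q∣ (component-mono {C = B} {D = M} (component-stays ¬xCz))))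

      u-joins : component B w ⊂ component M u
      u-joins = component-mono {C = B} {D = M} (λ wCt → Comp-trans uCw (component-stays ¬xCw wCt))
              , u , ∈-component⁺ M (Comp-refl u∉M)
              , λ u∈ → Comp-white (∈-component⁻ B {w} u∈) u∈B
        where
        uCw : SameComponent G (∁ M) u w
        uCw = Comp-extend (Comp-refl u∉M) u~w (white-stays w∉B ¬xCw)

      weight-u : weight B u + suc (n * k) ≤ k + weight M u
      -- `k + n * k` is the weight of a vertex whose component has one vertex more than that of `w`;
      -- the component of `u` in `M` is at least that large.
      weight-u = +-mono-≤ (weight-blue u∈B) (≤-trans (+-monoˡ-≤ (n * k) 1≤k)
        (^-monoʳ-≤ (suc n) (p⊂q⇒∣p∣<∣q∣ u-joins)))

    -- The losses total at most `n * k`, while `u` contributes a surplus of `1 + n * k`.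
    potential-increases : potential B < potential M
    potential-increases = +-cancelˡ-≤ (n * k) _ _ (begin
      n * k + suc (potential B) ≡⟨ +-suc (n * k) _ ⟩
      suc (n * k + potential B) ≡⟨ +-comm (suc (n * k)) _ ⟩
      potential B + suc (n * k) ≤⟨ ∑-≤-at u weight-≤ weight-u ⟩
      n * k + potential M       ∎)
      where open ≤-Reasoning

  -- Climbing to a standard forcing set.

  module _ (cf : ClawFree G) {B S : Subset n} (forcing : ForcingSet (psdRule G) B) (B⊆S : B ⊆ S)
           (stuck : Stuck (standardRule? G) S) {x : Fin n} (x∉S : x ∉ S)
           (x-least : ∀ y → y ∉ S → ∣ component B x ∣ ≤ ∣ component B y ∣) where

    private
      xCx : SameComponent G (∁ B) x x
      xCx = Comp-refl (x∉S ∘ B⊆S)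

      Improved : Set
      Improved = ∃[ M ] (ForcingSet (psdRule G) M × ∣ M ∣ ≤ ∣ B ∣ × potential B < potential M)

      search : ∀ {A M} → Migration B x A M → A ⊆ S → Acc _⊃_ A → Improved
      search {A} {M} μ A⊆S (acc rec)
        with nextForce (Migration.B⊆A μ) forcing xCx (x∉S ∘ A⊆S)
      ... | u , v , u∈A , v∉A , xCv , force@(u~v , only) with v ∈? S
      ...   | yes v∈S = search (migrate cf μ u∈A v∉A xCv force) A′⊆S
                (rec (p⊆p∪q ⁅ v ⁆ , v , x∈p∪⁅x⁆ A v , v∉A))
        where
        A′⊆S : A ∪ ⁅ v ⁆ ⊆ S
        A′⊆S y∈ with y∈p∪⁅x⁆⁻ A v y∈
        ... | inj₁ y∈A  = A⊆S y∈A
        ... | inj₂ refl = v∈S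
      ...   | no v∉S
        with any? (λ w → ¬? (w ∈? S) ×-dec ((u ~? w) ×-dec ¬? (w ≟ v)))
      -- With no second neighbour of `u` outside `S`, the force would be standard and `S` not stuck.
      ...     | no none = ⊥-elim (stuck u v (A⊆S u∈A) v∉S (u~v , λ w w∉S u~w →
                  decidable-stable (w ≟ v) λ w≢v → none (w , w∉S , u~w , w≢v)))
      ...     | yes (w , w∉S , u~w , w≢v) =
        _ , M-forcing , ∣M∣≤∣B∣ ,
        potential-increases μ′ u∈B (replaced cf μ u∈A v∉A xCv force) u~w (w∉S ∘ B⊆S) ¬xCw (x-least w w∉S)
        where
        μ′ = migrate cf μ u∈A v∉A xCv force
        open Migration μ′
        w∉A = w∉S ∘ A⊆S
        ¬xCw : ¬ SameComponent G (∁ B) x w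
        ¬xCw xCw = w≢v (only w (x∉p⇒x∈∁p v∉A , x∉p⇒x∈∁p w∉A , Migration.connected μ xCv xCw v∉A w∉A) u~w)
        -- A white `u` would join `w` to `v`, putting `w` into the component of `x`.
        u∈B : u ∈ B
        u∈B = decidable-stable (u ∈? B) λ u∉B →
          ¬xCw (Comp-extend (Comp-extend xCv (~-sym u~v) u∉B) u~w (w∉S ∘ B⊆S))

    -- As `x` is outside `S`, the forces in its component cannot all stay within `S`. The first one
    -- to leave `S` has its forcing vertex adjacent to another component, which is at least as large
    -- by the choice of `x`.
    improve : Improved
    improve = search (start forcing) B⊆S (⊃-wellFounded B)

  -- Unless the standard closure of `B` is everything, `B` can be exchanged for a set of larger
  -- potential and no larger size; the potential is bounded.
  psd⇒standard : ClawFree G → ∀ B → ForcingSet (psdRule G) B →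
                 ∃[ S ] (ForcingSet (standardRule G) S × ∣ S ∣ ≤ ∣ B ∣)
  psd⇒standard cf B forcing = climb B forcing (<-wellFounded _)
    where
    climb : ∀ B → ForcingSet (psdRule G) B → Acc _<_ (potentialBound ∸ potential B) →
            ∃[ S ] (ForcingSet (standardRule G) S × ∣ S ∣ ≤ ∣ B ∣)
    climb B forcing (acc rec) with closure (standardRule? G) B
    ... | S , B→S , B⊆S , stuck with missing-or-⊤ S
    ...   | inj₂ refl = B , B→S , ≤-refl
    ...   | inj₁ missing
      with least (λ y → ¬? (y ∈? S)) (λ y → ∣ component B y ∣) missing
    ...     | x , x∉S , x-least with improve cf forcing B⊆S stuck x∉S x-least
    ...       | M , M-forcing , M≤B , B<M
      with climb M M-forcing (rec (∸-monoʳ-< B<M (potential≤ M)))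
    ...         | S′ , S′-forcing , S′≤M = S′ , S′-forcing , ≤-trans S′≤M M≤B

clawFree⇒Z₊≡Z : (G : Graph n) → ClawFree G → Z₊ G ≡ Z G
clawFree⇒Z₊≡Z G cf
  with forcingNumber (psdRule? G) | forcingNumber (standardRule? G)
... | _ , (B , B-forcing , refl) , B-least | _ , (C , C-forcing , refl) , C-least
  with psd⇒standard G cf B B-forcing
... | S , S-forcing , S≤B =
  ≤-antisym (B-least C (standard⇒psd G C-forcing)) (≤-trans (C-least S S-forcing) S≤B)

-- Forcing numbers of the claw.

centre-psdForcing : ForcingSet (psdRule K₁,₃) ⁅ zero ⁆
centre-psdForcing = step (λ _ → ∈⊤) newly ◅ ε
  where
  leaf-isolated : ∀ {i w} → Star (EdgeIn K₁,₃ (∁ ⁅ zero ⁆)) (suc i) w → w ≡ suc i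
  leaf-isolated ε = refl
  leaf-isolated ((_ , 0∈ , inn _) ◅ _) = ⊥-elim (x∈∁p⇒x∉p 0∈ (x∈⁅x⁆ zero))
  newly : ∀ v → v ∈ ⊤ → v ∉ ⁅ zero ⁆ → ∃[ u ] (u ∈ ⁅ zero ⁆ × psdRule K₁,₃ ⁅ zero ⁆ u v)
  newly zero    _ v∉ = ⊥-elim (v∉ (x∈⁅x⁆ zero))
  newly (suc i) _ _  = zero , x∈⁅x⁆ zero , out i , λ w (_ , _ , p) _ → leaf-isolated p

-- Only the centre can force a leaf, and two white leaves block it in every step.
white-leaves-stay : ∀ {B i j} → i ≢ j → suc i ∉ B → suc j ∉ B → ¬ ForcingSet (standardRule K₁,₃) B
white-leaves-stay i≢j i∉B j∉B ε = i∉B ∈⊤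
white-leaves-stay {B} i≢j i∉B j∉B (_◅_ {j = B′} (step _ newly) p) =
  white-leaves-stay i≢j (stays i≢j i∉B j∉B) (stays (i≢j ∘ sym) j∉B i∉B) p
  where
  stays : ∀ {i j} → i ≢ j → suc i ∉ B → suc j ∉ B → suc i ∉ B′
  stays {i} {j} i≢j i∉B j∉B i∈B′ with newly (suc i) i∈B′ i∉B
  ... | zero , _ , out _ , only with only (suc j) j∉B (out j)
  ...   | refl = i≢j refl

two-white-leaves : (B : Subset 4) → ∣ B ∣ ≤ 1 → ∃[ i ] ∃[ j ] (i ≢ j × suc i ∉ B × suc j ∉ B)
two-white-leaves (_ ∷ false ∷ false ∷ _ ∷ []) _ =
  zero , suc zero , (λ ()) , (λ { (there ()) }) , λ { (there (there ())) }
two-white-leaves (_ ∷ false ∷ true ∷ false ∷ []) _ =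
  zero , suc (suc zero) , (λ ()) , (λ { (there ()) }) , λ { (there (there (there ()))) }
two-white-leaves (_ ∷ true ∷ false ∷ false ∷ []) _ =
  suc zero , suc (suc zero) , (λ ()) , (λ { (there (there ())) }) , λ { (there (there (there ()))) }
two-white-leaves (true  ∷ true ∷ true ∷ _ ∷ []) (s≤s ())
two-white-leaves (false ∷ true ∷ true ∷ _ ∷ []) (s≤s ())
two-white-leaves (true  ∷ true ∷ false ∷ true ∷ []) (s≤s ())
two-white-leaves (false ∷ true ∷ false ∷ true ∷ []) (s≤s ())
two-white-leaves (true  ∷ false ∷ true ∷ true ∷ []) (s≤s ())
two-white-leaves (false ∷ false ∷ true ∷ true ∷ []) (s≤s ())

K₁,₃-Z₊≢Z : Z₊ K₁,₃ ≢ Z K₁,₃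
K₁,₃-Z₊≢Z with forcingNumber (psdRule? K₁,₃) | forcingNumber (standardRule? K₁,₃)
-- The centre alone gives `k` at most 1, so equality would make `B` a standard forcing set with at
-- most one vertex.
... | k , _ , least₊ | _ , (B , B-forcing , refl) , _ = λ { refl →
  let i , j , i≢j , i∉B , j∉B = two-white-leaves B (least₊ ⁅ zero ⁆ centre-psdForcing)
  in white-leaves-stay i≢j i∉B j∉B B-forcing }

corollary6 : (n : ℕ) (G : Graph n) → Z₊Z-Perfect G ⇔ ClawFree G
corollary6 n G = mk⇔ perfect⇒clawFree clawFree⇒perfect
  where
  perfect⇒clawFree : Z₊Z-Perfect G → ClawFree G
  perfect⇒clawFree perfect K≤G = K₁,₃-Z₊≢Z (perfect K₁,₃ K≤G)
  clawFree⇒perfect : ClawFree G → Z₊Z-Perfect G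
  clawFree⇒perfect cf H H≤G = clawFree⇒Z₊≡Z H λ K≤H → cf (InducedSubgraph-trans K≤H H≤G)
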